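{- For every integer $n \ge 1$, we have \[ \nu_3 \left( \sum_{r = 0}^n \binom{n}{r}^3 2^r \right) = \begin{cases} s_3 \left( \dfrac{n - 1}{2} \right) + 1 &\text{if } n \text{ is odd}, \\[1ex] s_3 \left( \dfrac{n}{2} \right) &\text{if } n \text{ is even}. \end{cases} \]
   Context: For a nonzero integer $a$, $\nu_3(a)$ denotes the $3$-adic valuation of $a$, i.e. the largest integer $e \ge 0$ such that $3^e$ divides $a$. For a nonnegative integer $k$, $s_3(k)$ denotes the sum of the digits of $k$ written in base $3$ (so $s_3(0) = 0$). -}

module Defs where

open import Data.Digit using (toDigits)
open import Data.Fin.Base using (toℕ)
open import Data.Integer.Base as ℤ using (ℤ; +_; ∣_∣)
import Data.Integer.Divisibility as ℤ
open import Data.List.Base using (List; map; filter; upTo)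
open import Data.List.Extrema using (max; argmax-all; xs≤max)
open import Data.List.Membership.Propositional.Properties
  using (∈-filter⁺; ∈-upTo⁺)
open import Data.List.Relation.Unary.All using (lookup)
open import Data.List.Relation.Unary.All.Properties using (all-filter)
open import Data.Nat.Base
open import Data.Nat.Divisibility using (_∣?_; ∣⇒≤; 1∣_)
open import Data.Nat.ListAction using (sum)
open import Data.Nat.Properties
open import Data.Product.Base using (proj₁)
open import Function.Base using (id)

exponents : ℤ → List ℕ
exponents a = filter (λ e → 3 ^ e ∣? ∣ a ∣) (upTo ∣ a ∣)

-- The largest e such that 3 ^ e divides a. The search can be restricted to
-- e < ∣ a ∣ because e < 3 ^ e ≤ ∣ a ∣ whenever 3 ^ e divides a ≢ 0; see
-- ν₃-divides and ν₃-largest for the characterisation without a bound.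

ν₃ : (a : ℤ) .{{_ : ℤ.NonZero a}} → ℕ
ν₃ a = max ≤-totalOrder 0 (exponents a)

ν₃-divides : ∀ a .{{_ : ℤ.NonZero a}} → + (3 ^ ν₃ a) ℤ.∣ a
ν₃-divides a =
  argmax-all ≤-totalOrder id (1∣ ∣ a ∣)
    (all-filter (λ e → 3 ^ e ∣? ∣ a ∣) (upTo ∣ a ∣))

ν₃-largest : ∀ a .{{_ : ℤ.NonZero a}} e → + (3 ^ e) ℤ.∣ a → e ≤ ν₃ a
ν₃-largest a e 3^e∣a =
  lookup (xs≤max ≤-totalOrder 0 (exponents a))
    (∈-filter⁺ (λ e → 3 ^ e ∣? ∣ a ∣)
      (∈-upTo⁺ (<-≤-trans (n<3^n e) (∣⇒≤ 3^e∣a))) 3^e∣a)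
  where
  n<3^n : ∀ n → n < 3 ^ n
  n<3^n zero    = z<s
  n<3^n (suc n) = ≤-<-trans (n<3^n n) (^-monoʳ-< 3 (s<s z<s) (n<1+n n))

-- Superfluous zeros in the expansion, such as the single digit 0 that
-- toDigits gives for 0, do not affect the sum.

s₃ : ℕ → ℕ
s₃ k = sum (map toℕ (proj₁ (toDigits 3 k)))

{-# OPTIONS --safe #-}
module Submission where

-- MacMahon's identity
--   Σ_r C(n,r)³ 2^r = Σ_j C(n+j,j) C(n,j) C(n-j,j) 2^j 3^(n-2j)
-- gives a sum with a single term of least 3-adic valuation. The term at j
-- equals (n+j)! 2^j 3^(n-2j) / (j!³ (n-2j)!), and by Legendre's formula
-- 2 ν₃(m!) = m - s₃(m) the term at j = ⌊n/2⌋ has the asserted valuation while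
-- all others have a larger one.
--
-- Upon expanding 3^(n-2j) = (1+2)^(n-2j), MacMahon's identity follows from
--   C(a+b,b)² = Σ_j C(a,j) C(b,j) C(a+b+j,j),
-- which is proved by induction on a with a WZ certificate.

open import Defs
open import Data.Digit using (toDigits; fromDigits; Expansion)
open import Data.Fin.Base as Fin using (Fin; toℕ)
open import Data.Integer.Base as ℤ using (+_)
open import Data.List.Base using (applyUpTo; map; upTo; []; _∷_)
open import Data.List.Properties using (map-upTo)
open import Data.Nat.Base
open import Data.Nat.Combinatorics
open import Data.Nat.Divisibility
open import Data.Nat.DivMod
open import Data.Nat.ListAction using (sum)
open import Data.Nat.Primality using (Prime; prime?; euclidsLemma)
open import Data.Nat.Properties
open import Data.Nat.Tactic.RingSolver using (solve-∀)
open import Data.Product.Base using (∃-syntax; _×_; _,_; proj₁; proj₂)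
open import Data.Sum.Base using ([_,_]′; inj₁; inj₂)
open import Function.Base using (_∘_)
open import Relation.Binary.Definitions using (tri<; tri≈; tri>)
open import Relation.Binary.PropositionalEquality
open import Relation.Nullary using (yes; no; contradiction)
open import Relation.Nullary.Decidable using (from-yes; from-no)
open ≤-Reasoning

-- Absorption rules and symmetry for binomial coefficients

C-! : ∀ p q → ((p + q) C p) * (p ! * q !) ≡ (p + q) !
C-! p q = begin-equality
  ((p + q) C p) * (p ! * q !)
    ≡⟨ cong (λ r → ((p + q) C p) * (p ! * r !)) (m+n∸m≡n p q) ⟨
  ((p + q) C p) * (p ! * (p + q ∸ p) !)
    ≡⟨ cong (_* (p ! * (p + q ∸ p) !)) (nCk≡n!/k![n-k]! p≤p+q) ⟩
  (p + q) ! / (p ! * (p + q ∸ p) !) * (p ! * (p + q ∸ p) !)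
    ≡⟨ m/n*n≡m (k![n∸k]!∣n! p≤p+q) ⟩
  (p + q) ! ∎
  where
  p≤p+q = m≤m+n p q
  instance _ = p !* (p + q ∸ p) !≢0

C-absorb : ∀ n k → (suc n C suc k) * suc k ≡ suc n * (n C k)
C-absorb n k with k ≤? n
... | no k≰n = begin-equality
  (suc n C suc k) * suc k ≡⟨ cong (_* suc k) (k>n⇒nCk≡0 (s<s (≰⇒> k≰n))) ⟩
  0                       ≡⟨ *-zeroʳ (suc n) ⟨
  suc n * 0               ≡⟨ cong (suc n *_) (k>n⇒nCk≡0 (≰⇒> k≰n)) ⟨
  suc n * (n C k)         ∎
... | yes k≤n with e , refl ← m≤n⇒∃[o]m+o≡n k≤n =
  *-cancelʳ-≡ _ _ (k ! * e !) {{k !* e !≢0}} (begin-equality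
    (suc n C suc k) * suc k * (k ! * e !)   ≡⟨ lemma (suc n C suc k) (suc k) (k !) (e !) ⟩
    (suc n C suc k) * (suc k ! * e !)       ≡⟨ C-! (suc k) e ⟩
    suc n * (k + e) !                       ≡⟨ cong (suc n *_) (C-! k e) ⟨
    suc n * ((n C k) * (k ! * e !))         ≡⟨ *-assoc (suc n) (n C k) _ ⟨
    suc n * (n C k) * (k ! * e !)           ∎)
  where
  lemma : ∀ a b c d → a * b * (c * d) ≡ a * (b * c * d)
  lemma = solve-∀

C-absorb-upper : ∀ m k → (suc (m + k) C k) * suc m ≡ suc (m + k) * ((m + k) C k)
C-absorb-upper m k = *-cancelʳ-≡ _ _ (k ! * m !) {{k !* m !≢0}} (begin-equality
  (suc (m + k) C k) * suc m * (k ! * m !)  ≡⟨ lemma (suc (m + k) C k) (suc m) (k !) (m !) ⟩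
  (suc (m + k) C k) * (k ! * suc m !)      ≡⟨ cong (λ n → (n C k) * (k ! * suc m !)) (+-comm (suc m) k) ⟩
  ((k + suc m) C k) * (k ! * suc m !)      ≡⟨ C-! k (suc m) ⟩
  (k + suc m) !                            ≡⟨ cong _! (+-comm k (suc m)) ⟩
  suc (m + k) * (m + k) !                  ≡⟨ cong (λ n → suc (m + k) * n !) (+-comm m k) ⟩
  suc (m + k) * (k + m) !                  ≡⟨ cong (suc (m + k) *_) (C-! k m) ⟨
  suc (m + k) * (((k + m) C k) * (k ! * m !)) ≡⟨ cong (λ n → suc (m + k) * ((n C k) * (k ! * m !))) (+-comm k m) ⟩
  suc (m + k) * (((m + k) C k) * (k ! * m !)) ≡⟨ *-assoc (suc (m + k)) ((m + k) C k) _ ⟨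
  suc (m + k) * ((m + k) C k) * (k ! * m !)   ∎)
  where
  lemma : ∀ a b c d → a * b * (c * d) ≡ a * (c * (b * d))
  lemma = solve-∀

-- Adding `suc k * x` to both sides turns the claim into Pascal's rule followed by `C-absorb`.
C-next : ∀ k e → ((k + e) C suc k) * suc k ≡ e * ((k + e) C k)
C-next k e = +-cancelˡ-≡ (suc k * x) _ _ (begin-equality
  suc k * x + X * suc k       ≡⟨ lemma (suc k) x X ⟩
  (x + X) * suc k             ≡⟨ cong (_* suc k) (nCk+nC[k+1]≡[n+1]C[k+1] (k + e) k) ⟩
  (suc (k + e) C suc k) * suc k ≡⟨ C-absorb (k + e) k ⟩
  (suc k + e) * x             ≡⟨ *-distribʳ-+ x (suc k) e ⟩
  suc k * x + e * x           ∎)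
  where
  x = (k + e) C k
  X = (k + e) C suc k
  lemma : ∀ i x X → i * x + X * i ≡ (x + X) * i
  lemma = solve-∀

-- Truncated subtraction does no harm: for p > n the first factor is 0, and otherwise n - p < j
-- makes the second one 0.
C-swap-zero : ∀ n p j → n < p + j → (n C p) * ((n ∸ p) C j) ≡ 0
C-swap-zero n p j n<p+j with p ≤? n
... | no  p≰n = cong (_* ((n ∸ p) C j)) (k>n⇒nCk≡0 (≰⇒> p≰n))
... | yes p≤n = begin-equality
  (n C p) * ((n ∸ p) C j)
    ≡⟨ cong ((n C p) *_) (k>n⇒nCk≡0 (+-cancelˡ-< p _ _ (subst (_< p + j) (sym (m+[n∸m]≡n p≤n)) n<p+j))) ⟩
  (n C p) * 0 ≡⟨ *-zeroʳ (n C p) ⟩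
  0 ∎

C-trinomial : ∀ p j s →
  ((p + (j + s)) C p) * (((p + (j + s)) ∸ p) C j) * (p ! * (j ! * s !)) ≡ (p + (j + s)) !
C-trinomial p j s = begin-equality
  ((p + (j + s)) C p) * (((p + (j + s)) ∸ p) C j) * (p ! * (j ! * s !))
    ≡⟨ cong (λ n → ((p + (j + s)) C p) * (n C j) * (p ! * (j ! * s !))) (m+n∸m≡n p (j + s)) ⟩
  ((p + (j + s)) C p) * ((j + s) C j) * (p ! * (j ! * s !))
    ≡⟨ lemma ((p + (j + s)) C p) ((j + s) C j) (p !) (j ! * s !) ⟩
  ((p + (j + s)) C p) * (p ! * (((j + s) C j) * (j ! * s !)))
    ≡⟨ cong (λ x → ((p + (j + s)) C p) * (p ! * x)) (C-! j s) ⟩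
  ((p + (j + s)) C p) * (p ! * (j + s) !)
    ≡⟨ C-! p (j + s) ⟩
  (p + (j + s)) ! ∎
  where
  lemma : ∀ a b c d → a * b * (c * d) ≡ a * (c * (b * d))
  lemma = solve-∀

-- With s = n - p - j, both sides are the trinomial coefficient n! / (p! j! s!), which is symmetric
-- in p and j. Outside the range p + j ≤ n both vanish.
C-swap : ∀ n p j → (n C p) * ((n ∸ p) C j) ≡ (n C j) * ((n ∸ j) C p)
C-swap n p j with p + j ≤? n
... | no p+j≰n =
  trans (C-swap-zero n p j (≰⇒> p+j≰n))
        (sym (C-swap-zero n j p (subst (n <_) (+-comm p j) (≰⇒> p+j≰n))))
... | yes p+j≤n with s , refl ← m≤n⇒∃[o]m+o≡n p+j≤n =
  *-cancelʳ-≡ _ _ (p ! * (j ! * s !)) {{m*n≢0 _ _ {{p !≢0}} {{j !* s !≢0}}}} (begin-equality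
    (n C p) * ((n ∸ p) C j) * (p ! * (j ! * s !))
      ≡⟨ cong (λ n → (n C p) * ((n ∸ p) C j) * (p ! * (j ! * s !))) (+-assoc p j s) ⟩
    _ ≡⟨ C-trinomial p j s ⟩
    (p + (j + s)) !
      ≡⟨ cong _! p+[j+s]≡j+[p+s] ⟩
    (j + (p + s)) !
      ≡⟨ C-trinomial j p s ⟨
    _ ≡⟨ cong (λ n → (n C j) * ((n ∸ j) C p) * (j ! * (p ! * s !))) (trans (sym p+[j+s]≡j+[p+s]) (sym (+-assoc p j s))) ⟩
    (n C j) * ((n ∸ j) C p) * (j ! * (p ! * s !))
      ≡⟨ cong ((n C j) * ((n ∸ j) C p) *_) (lemma (j !) (p !) (s !)) ⟩
    (n C j) * ((n ∸ j) C p) * (p ! * (j ! * s !)) ∎)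
  where
  p+[j+s]≡j+[p+s] : p + (j + s) ≡ j + (p + s)
  p+[j+s]≡j+[p+s] = trans (sym (+-assoc p j s)) (trans (cong (_+ s) (+-comm p j)) (+-assoc j p s))
  lemma : ∀ a b c → a * (b * c) ≡ b * (a * c)
  lemma = solve-∀

-- Finite sums and the binomial theorem for (1+2)^d

∑ : ℕ → (ℕ → ℕ) → ℕ
∑ k f = sum (applyUpTo f k)

∑-cong : ∀ k {f g} → (∀ i → i < k → f i ≡ g i) → ∑ k f ≡ ∑ k g
∑-cong zero    f≡g = refl
∑-cong (suc k) f≡g = cong₂ _+_ (f≡g 0 z<s) (∑-cong k λ i i<k → f≡g (suc i) (s<s i<k))

∑-last : ∀ k f → ∑ (suc k) f ≡ ∑ k f + f k
∑-last zero    f = +-comm (f 0) 0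
∑-last (suc k) f = trans (cong (λ t → f 0 + t) (∑-last k (f ∘ suc))) (sym (+-assoc (f 0) _ _))

∑-+ : ∀ k f g → ∑ k (λ i → f i + g i) ≡ ∑ k f + ∑ k g
∑-+ zero    f g = refl
∑-+ (suc k) f g = trans (cong (λ t → f 0 + g 0 + t) (∑-+ k (f ∘ suc) (g ∘ suc)))
  (lemma (f 0) (g 0) (∑ k (f ∘ suc)) (∑ k (g ∘ suc)))
  where
  lemma : ∀ a b c d → a + b + (c + d) ≡ a + c + (b + d)
  lemma = solve-∀

∑-*ˡ : ∀ k c f → ∑ k (λ i → c * f i) ≡ c * ∑ k f
∑-*ˡ zero    c f = sym (*-zeroʳ c)
∑-*ˡ (suc k) c f = trans (cong (λ t → c * f 0 + t) (∑-*ˡ k c (f ∘ suc))) (sym (*-distribˡ-+ c (f 0) _))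

∑-zero : ∀ k {f} → (∀ i → i < k → f i ≡ 0) → ∑ k f ≡ 0
∑-zero k f≡0 = trans (∑-cong k f≡0) (∑-*ˡ k 0 λ _ → 0)

∑-swap : ∀ k l (f : ℕ → ℕ → ℕ) → ∑ k (λ i → ∑ l (f i)) ≡ ∑ l (λ j → ∑ k (λ i → f i j))
∑-swap zero    l f = sym (∑-zero l λ _ _ → refl)
∑-swap (suc k) l f = trans (cong (λ t → ∑ l (f 0) + t) (∑-swap k l (f ∘ suc)))
  (sym (∑-+ l (f 0) (λ j → ∑ k (λ i → f (suc i) j))))

∑-split : ∀ k l f → ∑ (k + l) f ≡ ∑ k f + ∑ l (λ i → f (k + i))
∑-split zero    l f = refl
∑-split (suc k) l f = trans (cong (λ t → f 0 + t) (∑-split k l (f ∘ suc))) (sym (+-assoc (f 0) _ _))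

-- The upper limit stays free because Pascal's rule needs the claim for d at both `k` and `suc k`.
∑-binomial : ∀ d k → d < k → ∑ k (λ p → 2 ^ p * (d C p)) ≡ 3 ^ d
∑-binomial zero    (suc k) _         = cong suc (∑-zero k λ p _ →
  trans (cong (2 ^ suc p *_) (k>n⇒nCk≡0 {0} {suc p} z<s)) (*-zeroʳ (2 ^ suc p)))
∑-binomial (suc d) (suc k) (s<s d<k) = begin-equality
  1 + ∑ k (λ p → 2 ^ suc p * (suc d C suc p))
    ≡⟨ cong suc (∑-cong k λ p _ → begin-equality
         2 ^ suc p * (suc d C suc p)
           ≡⟨ cong (2 ^ suc p *_) (nCk+nC[k+1]≡[n+1]C[k+1] d p) ⟨
         2 ^ suc p * ((d C p) + (d C suc p))
           ≡⟨ lemma (2 ^ p) (d C p) (d C suc p) ⟩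
         2 * (2 ^ p * (d C p)) + 2 ^ suc p * (d C suc p) ∎) ⟩
  1 + ∑ k (λ p → 2 * (2 ^ p * (d C p)) + 2 ^ suc p * (d C suc p))
    ≡⟨ cong suc (∑-+ k _ _) ⟩
  1 + (∑ k (λ p → 2 * (2 ^ p * (d C p))) + ∑ k (λ p → 2 ^ suc p * (d C suc p)))
    -- The leading 1 becomes the p = 0 term of the second sum.
    ≡⟨ +-suc _ _ ⟨
  ∑ k (λ p → 2 * (2 ^ p * (d C p))) + ∑ (suc k) (λ p → 2 ^ p * (d C p))
    ≡⟨ cong₂ _+_ (trans (∑-*ˡ k 2 _) (cong (2 *_) (∑-binomial d k d<k))) (∑-binomial d (suc k) (m<n⇒m<1+n d<k)) ⟩
  2 * 3 ^ d + 3 ^ d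
    ≡⟨ +-comm (2 * 3 ^ d) (3 ^ d) ⟩
  3 ^ suc d ∎
  where
  lemma : ∀ a b c → 2 * a * (b + c) ≡ 2 * (a * b) + 2 * a * c
  lemma = solve-∀

-- WZ proof of the formula for the squared binomial coefficient

summand : ℕ → ℕ → ℕ → ℕ
summand a b j = (a C j) * (b C j) * ((a + b + j) C j)

summand-zero : ∀ a {b j} → b < j → summand a b j ≡ 0
summand-zero a {b} {j} b<j = begin-equality
  (a C j) * (b C j) * ((a + b + j) C j) ≡⟨ cong (λ x → (a C j) * x * ((a + b + j) C j)) (k>n⇒nCk≡0 b<j) ⟩
  (a C j) * 0 * ((a + b + j) C j)       ≡⟨ cong (_* ((a + b + j) C j)) (*-zeroʳ (a C j)) ⟩
  0                                     ∎

-- With A = a + 1 and N = a + b + 1, Zeilberger's recurrence is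
--   N A² summand (a + 1) b j - N³ summand a b j = G (j + 1) - G j,
-- where G (j + 1) = - certificate a b j and G 0 = 0.
certificate : ℕ → ℕ → ℕ → ℕ
certificate a b k = (suc a + suc (a + b)) * (b ∸ k) * (suc (a + b) + k) * summand a b k

certificate-zero : ∀ a {b k} → b ≤ k → certificate a b k ≡ 0
certificate-zero a {b} {k} b≤k = begin-equality
  (suc a + suc (a + b)) * (b ∸ k) * (suc (a + b) + k) * summand a b k
    ≡⟨ cong (λ d → (suc a + suc (a + b)) * d * (suc (a + b) + k) * summand a b k) (m≤n⇒m∸n≡0 b≤k) ⟩
  (suc a + suc (a + b)) * 0 * (suc (a + b) + k) * summand a b k
    ≡⟨ cong (λ d → d * (suc (a + b) + k) * summand a b k) (*-zeroʳ (suc a + suc (a + b))) ⟩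
  0 ∎

-- wz-step divided by (b C i) * ((a + b + i) C i), where i = k + 1 and b = i + c.
wz-reduced : ∀ a k c → let i = suc k; N = suc (a + (i + c)) in
  suc a * suc a * ((suc a C i) * (N + i)) + (suc a + N) * c * (N + i) * (a C i)
    ≡ N * N * N * (a C i) + (suc a + N) * (i * i) * (a C k)
wz-reduced a k c with k ≤? a
... | no k≰a
  rewrite k>n⇒nCk≡0 (≰⇒> k≰a) | k>n⇒nCk≡0 {suc a} {suc k} (s<s (≰⇒> k≰a))
        | k>n⇒nCk≡0 {a} {suc k} (m<n⇒m<1+n (≰⇒> k≰a)) =
  lemma (suc a) (suc (a + (suc k + c))) (suc k) c
  where
  lemma : ∀ A N i c → A * A * 0 + (A + N) * c * (N + i) * 0 ≡ N * N * N * 0 + (A + N) * (i * i) * 0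
  lemma = solve-∀
-- After multiplication by `i`, both `T * i` and `X * i` are multiples of `x`, and only the
-- polynomial identity `core` in i, e, c remains, where a = k + e.
... | yes k≤a with e , refl ← m≤n⇒∃[o]m+o≡n k≤a = *-cancelʳ-≡ _ _ i (begin-equality
  (A * A * (T * (N + i)) + (A + N) * c * (N + i) * X) * i
    ≡⟨ regroupˡ A T N i c X ⟩
  A * A * (T * i * (N + i)) + (A + N) * c * (N + i) * (X * i)
    ≡⟨ cong₂ (λ p q → A * A * (p * (N + i)) + (A + N) * c * (N + i) * q) (C-absorb a k) (C-next k e) ⟩
  A * A * (A * x * (N + i)) + (A + N) * c * (N + i) * (e * x)
    ≡⟨ core i e c x ⟩
  N * N * N * (e * x) + (A + N) * (i * i) * (i * x)
    ≡⟨ cong (λ q → N * N * N * q + (A + N) * (i * i) * (i * x)) (C-next k e) ⟨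
  N * N * N * (X * i) + (A + N) * (i * i) * (i * x)
    ≡⟨ regroupʳ A N i X x ⟩
  (N * N * N * X + (A + N) * (i * i) * x) * i ∎)
  where
  i = suc k
  A = suc a
  N = suc (a + (i + c))
  T = A C i
  X = a C i
  x = a C k
  regroupˡ : ∀ A T N i c X → (A * A * (T * (N + i)) + (A + N) * c * (N + i) * X) * i
                           ≡ A * A * (T * i * (N + i)) + (A + N) * c * (N + i) * (X * i)
  regroupˡ = solve-∀
  regroupʳ : ∀ A N i X x → N * N * N * (X * i) + (A + N) * (i * i) * (i * x)
                         ≡ (N * N * N * X + (A + N) * (i * i) * x) * i
  regroupʳ = solve-∀
  core : ∀ i e c x → let A = i + e; N = A + (i + c) in
    A * A * (A * x * (N + i)) + (A + N) * c * (N + i) * (e * x)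
      ≡ N * N * N * (e * x) + (A + N) * (i * i) * (i * x)
  core = solve-∀

-- Zeilberger's recurrence at j = k + 1, with the subtracted terms moved across so that it can be
-- read in ℕ. For k ≥ b all four terms vanish.
wz-step : ∀ a b k → let A = suc a; N = suc (a + b) in
  N * (A * A) * summand A b (suc k) + certificate a b (suc k)
    ≡ N * N * N * summand a b (suc k) + certificate a b k
wz-step a b k with k <? b
... | no k≮b = begin-equality
  N * (A * A) * summand A b (suc k) + certificate a b (suc k)
    ≡⟨ cong₂ (λ p q → N * (A * A) * p + q) (summand-zero A (s≤s b≤k)) (certificate-zero a (m≤n⇒m≤1+n b≤k)) ⟩
  N * (A * A) * 0 + 0
    ≡⟨ cong (_+ 0) (trans (*-zeroʳ (N * (A * A))) (sym (*-zeroʳ (N * N * N)))) ⟩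
  N * N * N * 0 + 0
    ≡⟨ cong₂ (λ p q → N * N * N * p + q) (summand-zero a (s≤s b≤k)) (certificate-zero a b≤k) ⟨
  N * N * N * summand a b (suc k) + certificate a b k ∎
  where
  A = suc a
  N = suc (a + b)
  b≤k = ≮⇒≥ k≮b
... | yes k<b with c , refl ← m≤n⇒∃[o]m+o≡n k<b = begin-equality
  N * (A * A) * (T * Y * W) + (A + N) * (b ∸ i) * (N + i) * (X * Y * Z)
    ≡⟨ cong (λ d → N * (A * A) * (T * Y * W) + (A + N) * d * (N + i) * (X * Y * Z)) (m+n∸m≡n i c) ⟩
  N * (A * A) * (T * Y * W) + (A + N) * c * (N + i) * (X * Y * Z)
    ≡⟨ cong (_+ (A + N) * c * (N + i) * (X * Y * Z)) (move N A T Y W) ⟩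
  A * A * T * Y * (W * N) + (A + N) * c * (N + i) * (X * Y * Z)
    -- Absorbing N turns `W` into a multiple of `Z`, so that `Y * Z` becomes a common factor and
    -- `wz-reduced` applies.
    ≡⟨ cong (λ w → A * A * T * Y * w + (A + N) * c * (N + i) * (X * Y * Z)) (C-absorb-upper (a + b) i) ⟩
  A * A * T * Y * ((N + i) * Z) + (A + N) * c * (N + i) * (X * Y * Z)
    ≡⟨ collectˡ A T Y Z N i c X ⟩
  (A * A * (T * (N + i)) + (A + N) * c * (N + i) * X) * (Y * Z)
    ≡⟨ cong (_* (Y * Z)) (wz-reduced a k c) ⟩
  (N * N * N * X + (A + N) * (i * i) * x) * (Y * Z)
    -- One factor `i` goes to `Y` and the other to `Z`; each lowers the lower index from `i` to `k`.
    ≡⟨ collectʳ N X A i x Y Z ⟩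
  N * N * N * (X * Y * Z) + (A + N) * x * ((Y * i) * (Z * i))
    ≡⟨ cong₂ (λ p q → N * N * N * (X * Y * Z) + (A + N) * x * (p * q)) Yi≡[b∸k]y Zi≡[N+k]z ⟩
  N * N * N * (X * Y * Z) + (A + N) * x * (((b ∸ k) * y) * ((N + k) * z))
    ≡⟨ cong (λ t → N * N * N * (X * Y * Z) + t) (spread (A + N) x (b ∸ k) y (N + k) z) ⟩
  N * N * N * (X * Y * Z) + (A + N) * (b ∸ k) * (N + k) * (x * y * z) ∎
  where
  i = suc k
  A = suc a
  N = suc (a + b)
  T = A C i
  W = (A + b + i) C i
  X = a C i
  Y = b C i
  Z = (a + b + i) C i
  x = a C k
  y = b C k
  z = (a + b + k) C k
  Yi≡[b∸k]y : Y * i ≡ (b ∸ k) * y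
  Yi≡[b∸k]y = subst (λ b → (b C i) * i ≡ (b ∸ k) * (b C k)) (+-suc k c)
    (trans (C-next k (suc c)) (cong (_* ((k + suc c) C k)) (sym (m+n∸m≡n k (suc c)))))
  Zi≡[N+k]z : Z * i ≡ (N + k) * z
  Zi≡[N+k]z = trans (cong (λ n → (n C i) * i) (+-suc (a + b) k)) (C-absorb (a + b + k) k)
  move : ∀ N A T Y W → N * (A * A) * (T * Y * W) ≡ A * A * T * Y * (W * N)
  move = solve-∀
  collectˡ : ∀ A T Y Z N i c X → A * A * T * Y * ((N + i) * Z) + (A + N) * c * (N + i) * (X * Y * Z)
    ≡ (A * A * (T * (N + i)) + (A + N) * c * (N + i) * X) * (Y * Z)
  collectˡ = solve-∀
  collectʳ : ∀ N X A i x Y Z → (N * N * N * X + (A + N) * (i * i) * x) * (Y * Z)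
    ≡ N * N * N * (X * Y * Z) + (A + N) * x * ((Y * i) * (Z * i))
  collectʳ = solve-∀
  spread : ∀ s x d y n z → s * x * ((d * y) * (n * z)) ≡ s * d * n * (x * y * z)
  spread = solve-∀

-- The steps telescope. The base case, where G 0 = 0, is N times A² + (A + N) b = N², which holds
-- because b = N - A.
wz-sum : ∀ a b k → let A = suc a; N = suc (a + b) in
  N * (A * A) * ∑ (suc k) (summand A b) + certificate a b k ≡ N * N * N * ∑ (suc k) (summand a b)
wz-sum a b zero = lemma a b
  where
  lemma : ∀ a b → let A = suc a; N = suc (a + b) in
    N * (A * A) * 1 + (A + N) * b * (N + 0) * 1 ≡ N * N * N * 1
  lemma = solve-∀
wz-sum a b (suc k) = begin-equality
  N * (A * A) * ∑ (2 + k) (summand A b) + certificate a b (suc k)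
    ≡⟨ cong (λ s → N * (A * A) * s + certificate a b (suc k)) (∑-last (suc k) (summand A b)) ⟩
  N * (A * A) * (S′ + summand A b (suc k)) + certificate a b (suc k)
    ≡⟨ expand (N * (A * A)) S′ (summand A b (suc k)) _ ⟩
  N * (A * A) * S′ + (N * (A * A) * summand A b (suc k) + certificate a b (suc k))
    ≡⟨ cong (λ t → N * (A * A) * S′ + t) (wz-step a b k) ⟩
  N * (A * A) * S′ + (N * N * N * summand a b (suc k) + certificate a b k)
    ≡⟨ exchange (N * (A * A) * S′) (N * N * N * summand a b (suc k)) (certificate a b k) ⟩
  N * (A * A) * S′ + certificate a b k + N * N * N * summand a b (suc k)
    ≡⟨ cong (_+ N * N * N * summand a b (suc k)) (wz-sum a b k) ⟩
  N * N * N * S + N * N * N * summand a b (suc k)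
    ≡⟨ *-distribˡ-+ (N * N * N) S (summand a b (suc k)) ⟨
  N * N * N * (S + summand a b (suc k))
    ≡⟨ cong (N * N * N *_) (∑-last (suc k) (summand a b)) ⟨
  N * N * N * ∑ (2 + k) (summand a b) ∎
  where
  A = suc a
  N = suc (a + b)
  S = ∑ (suc k) (summand a b)
  S′ = ∑ (suc k) (summand A b)
  expand : ∀ p s t u → p * (s + t) + u ≡ p * s + (p * t + u)
  expand = solve-∀
  exchange : ∀ p q r → p + (q + r) ≡ p + r + q
  exchange = solve-∀

-- For k ≥ b the boundary term of `wz-sum` vanishes, so passing from a to a + 1 multiplies the sum
-- by N² / A². By `C-absorb-upper` the squared binomial coefficient grows by the same ratio.
∑-summand : ∀ a b k → b ≤ k → ∑ (suc k) (summand a b) ≡ ((a + b) C b) * ((a + b) C b)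
∑-summand zero b k b≤k = begin-equality
  1 + ∑ k (λ j → summand 0 b (suc j))
    ≡⟨ cong suc (∑-zero k λ j _ → cong (λ x → x * (b C suc j) * ((b + suc j) C suc j)) (k>n⇒nCk≡0 {0} {suc j} z<s)) ⟩
  1 * 1
    ≡⟨ cong₂ _*_ (nCn≡1 b) (nCn≡1 b) ⟨
  (b C b) * (b C b) ∎
∑-summand (suc a) b k b≤k = *-cancelˡ-≡ _ _ (N * (A * A)) (begin-equality
  N * (A * A) * ∑ (suc k) (summand A b)
    ≡⟨ +-identityʳ _ ⟨
  N * (A * A) * ∑ (suc k) (summand A b) + 0
    ≡⟨ cong (λ t → N * (A * A) * ∑ (suc k) (summand A b) + t) (certificate-zero a b≤k) ⟨
  N * (A * A) * ∑ (suc k) (summand A b) + certificate a b k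
    ≡⟨ wz-sum a b k ⟩
  N * N * N * ∑ (suc k) (summand a b)
    ≡⟨ cong (N * N * N *_) (∑-summand a b k b≤k) ⟩
  N * N * N * (u * u)
    ≡⟨ lemma₁ N u ⟩
  N * ((N * u) * (N * u))
    ≡⟨ cong (λ v → N * (v * v)) (C-absorb-upper a b) ⟨
  N * ((v * A) * (v * A))
    ≡⟨ lemma₂ N v A ⟩
  N * (A * A) * (v * v) ∎)
  where
  A = suc a
  N = suc (a + b)
  u = (a + b) C b
  v = N C b
  lemma₁ : ∀ N u → N * N * N * (u * u) ≡ N * ((N * u) * (N * u))
  lemma₁ = solve-∀
  lemma₂ : ∀ N v A → N * ((v * A) * (v * A)) ≡ N * (A * A) * (v * v)
  lemma₂ = solve-∀

-- MacMahon's identity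

macMahonTerm : ℕ → ℕ → ℕ
macMahonTerm n j = ((n + j) C j) * (n C j) * ((n ∸ j) C j) * 2 ^ j * 3 ^ (n ∸ j ∸ j)

-- Terms with r < j vanish. For r = j + p, the product C(n,r) C(r,j) C(n-r,j) equals C(n,j) C(n-j,j)
-- C(n-2j,p), and the sum over p is a case of `∑-binomial`.
∑-inner : ∀ n j → j ≤ n →
  ∑ (suc n) (λ r → 2 ^ r * (n C r) * ((r C j) * ((n ∸ r) C j)))
    ≡ (n C j) * ((n ∸ j) C j) * 2 ^ j * 3 ^ (n ∸ j ∸ j)
∑-inner n j j≤n with m , refl ← m≤n⇒∃[o]m+o≡n j≤n = begin-equality
  ∑ (suc (j + m)) f
    ≡⟨ cong (λ k → ∑ k f) (+-suc j m) ⟨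
  ∑ (j + suc m) f
    ≡⟨ ∑-split j (suc m) f ⟩
  ∑ j f + ∑ (suc m) (λ p → f (j + p))
    ≡⟨ cong (_+ ∑ (suc m) (λ p → f (j + p))) (∑-zero j below) ⟩
  ∑ (suc m) (λ p → f (j + p))
    ≡⟨ ∑-cong (suc m) (λ p p≤m → above p (s≤s⁻¹ p≤m)) ⟩
  ∑ (suc m) (λ p → c * (2 ^ p * ((n ∸ j ∸ j) C p)))
    ≡⟨ ∑-*ˡ (suc m) c (λ p → 2 ^ p * ((n ∸ j ∸ j) C p)) ⟩
  c * ∑ (suc m) (λ p → 2 ^ p * ((n ∸ j ∸ j) C p))
    ≡⟨ cong (c *_) (∑-binomial (n ∸ j ∸ j) (suc m) (s≤s (≤-trans (m∸n≤m (n ∸ j) j) (≤-reflexive (m+n∸m≡n j m))))) ⟩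
  c * 3 ^ (n ∸ j ∸ j) ∎
  where
  f : ℕ → ℕ
  f r = 2 ^ r * (n C r) * ((r C j) * ((n ∸ r) C j))
  c = (n C j) * ((n ∸ j) C j) * 2 ^ j
  below : ∀ r → r < j → f r ≡ 0
  below r r<j = begin-equality
    2 ^ r * (n C r) * ((r C j) * ((n ∸ r) C j))
      ≡⟨ cong (λ x → 2 ^ r * (n C r) * (x * ((n ∸ r) C j))) (k>n⇒nCk≡0 r<j) ⟩
    2 ^ r * (n C r) * 0
      ≡⟨ *-zeroʳ (2 ^ r * (n C r)) ⟩
    0 ∎
  above : ∀ p → p ≤ m → f (j + p) ≡ c * (2 ^ p * ((n ∸ j ∸ j) C p))
  -- With q = n - r, `C-swap` is applied twice: it exchanges q with j, and then p with j. The
  -- symmetry of binomial coefficients converts r to q before the first exchange and q to p after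
  -- it.
  above p p≤m with q , refl ← m≤n⇒∃[o]m+o≡n p≤m = begin-equality
    2 ^ r * (n C r) * ((r C j) * ((n ∸ r) C j))
      ≡⟨ cong₂ (λ s t → s * (n C r) * ((r C j) * (t C j))) (^-distribˡ-+-* 2 j p) n∸r≡q ⟩
    2 ^ j * 2 ^ p * (n C r) * ((r C j) * (q C j))
      ≡⟨ cong (λ x → 2 ^ j * 2 ^ p * x * ((r C j) * (q C j))) nCr≡nCq ⟩
    2 ^ j * 2 ^ p * (n C q) * ((r C j) * (q C j))
      ≡⟨ lemma₁ (2 ^ j) (2 ^ p) (n C q) (r C j) (q C j) ⟩
    2 ^ j * 2 ^ p * ((n C q) * (r C j)) * (q C j)
      ≡⟨ cong (λ r → 2 ^ j * 2 ^ p * ((n C q) * (r C j)) * (q C j)) n∸q≡r ⟨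
    2 ^ j * 2 ^ p * ((n C q) * ((n ∸ q) C j)) * (q C j)
      ≡⟨ cong (λ x → 2 ^ j * 2 ^ p * x * (q C j)) (C-swap n q j) ⟩
    2 ^ j * 2 ^ p * ((n C j) * ((n ∸ j) C q)) * (q C j)
      ≡⟨ cong (λ x → 2 ^ j * 2 ^ p * ((n C j) * x) * (q C j)) [n∸j]Cq≡[n∸j]Cp ⟩
    2 ^ j * 2 ^ p * ((n C j) * ((n ∸ j) C p)) * (q C j)
      ≡⟨ lemma₂ (2 ^ j) (2 ^ p) (n C j) ((n ∸ j) C p) (q C j) ⟩
    2 ^ j * 2 ^ p * (n C j) * (((n ∸ j) C p) * (q C j))
      ≡⟨ cong (λ q → 2 ^ j * 2 ^ p * (n C j) * (((n ∸ j) C p) * (q C j))) n∸j∸p≡q ⟨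
    2 ^ j * 2 ^ p * (n C j) * (((n ∸ j) C p) * ((n ∸ j ∸ p) C j))
      ≡⟨ cong (2 ^ j * 2 ^ p * (n C j) *_) (C-swap (n ∸ j) p j) ⟩
    2 ^ j * 2 ^ p * (n C j) * (((n ∸ j) C j) * ((n ∸ j ∸ j) C p))
      ≡⟨ lemma₃ (2 ^ j) (2 ^ p) (n C j) ((n ∸ j) C j) ((n ∸ j ∸ j) C p) ⟩
    c * (2 ^ p * ((n ∸ j ∸ j) C p)) ∎
    where
    r = j + p
    n≡r+q : n ≡ r + q
    n≡r+q = sym (+-assoc j p q)
    n∸r≡q : n ∸ r ≡ q
    n∸r≡q = trans (cong (_∸ r) n≡r+q) (m+n∸m≡n r q)
    n∸q≡r : n ∸ q ≡ r
    n∸q≡r = trans (cong (_∸ q) n≡r+q) (m+n∸n≡m r q)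
    n∸j≡p+q : n ∸ j ≡ p + q
    n∸j≡p+q = m+n∸m≡n j (p + q)
    n∸j∸p≡q : n ∸ j ∸ p ≡ q
    n∸j∸p≡q = trans (cong (_∸ p) n∸j≡p+q) (m+n∸m≡n p q)
    nCr≡nCq : n C r ≡ n C q
    nCr≡nCq = trans (nCk≡nC[n∸k] (+-monoʳ-≤ j p≤m)) (cong (n C_) n∸r≡q)
    [n∸j]Cq≡[n∸j]Cp : (n ∸ j) C q ≡ (n ∸ j) C p
    [n∸j]Cq≡[n∸j]Cp = sym (trans (nCk≡nC[n∸k] (≤-trans p≤m (≤-reflexive (sym n∸j≡p+q)))) (cong ((n ∸ j) C_) n∸j∸p≡q))
    lemma₁ : ∀ s t u v w → s * t * u * (v * w) ≡ s * t * (u * v) * w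
    lemma₁ = solve-∀
    lemma₂ : ∀ s t u v w → s * t * (u * v) * w ≡ s * t * u * (v * w)
    lemma₂ = solve-∀
    lemma₃ : ∀ s t u v w → s * t * u * (v * w) ≡ u * v * s * (t * w)
    lemma₃ = solve-∀

-- One factor C(n,r) is kept and the other two are expanded by `∑-summand` with a = n - r and b = r.
-- Then a + b + j = n + j does not depend on r, so C(n+j,j) leaves the inner sum once the order of
-- summation is exchanged.
macMahon : ∀ n → ∑ (suc n) (λ r → (n C r) ^ 3 * 2 ^ r) ≡ ∑ (suc n) (macMahonTerm n)
macMahon n = begin-equality
  ∑ (suc n) (λ r → (n C r) ^ 3 * 2 ^ r)
    ≡⟨ ∑-cong (suc n) (λ r r≤n → expand r (s≤s⁻¹ r≤n)) ⟩
  ∑ (suc n) (λ r → ∑ (suc n) (λ j → ((n + j) C j) * g r j))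
    ≡⟨ ∑-swap (suc n) (suc n) (λ r j → ((n + j) C j) * g r j) ⟩
  ∑ (suc n) (λ j → ∑ (suc n) (λ r → ((n + j) C j) * g r j))
    ≡⟨ ∑-cong (suc n) (λ j j≤n → inner j (s≤s⁻¹ j≤n)) ⟩
  ∑ (suc n) (macMahonTerm n) ∎
  where
  g : ℕ → ℕ → ℕ
  g r j = 2 ^ r * (n C r) * ((r C j) * ((n ∸ r) C j))
  expand : ∀ r → r ≤ n → (n C r) ^ 3 * 2 ^ r ≡ ∑ (suc n) (λ j → ((n + j) C j) * g r j)
  expand r r≤n = begin-equality
    (n C r) ^ 3 * 2 ^ r
      ≡⟨ lemma₁ (n C r) (2 ^ r) ⟩
    2 ^ r * (n C r) * ((n C r) * (n C r))
      ≡⟨ cong (λ m → 2 ^ r * (n C r) * ((m C r) * (m C r))) (m∸n+n≡m r≤n) ⟨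
    2 ^ r * (n C r) * (((n ∸ r + r) C r) * ((n ∸ r + r) C r))
      ≡⟨ cong (2 ^ r * (n C r) *_) (∑-summand (n ∸ r) r n r≤n) ⟨
    2 ^ r * (n C r) * ∑ (suc n) (summand (n ∸ r) r)
      ≡⟨ ∑-*ˡ (suc n) (2 ^ r * (n C r)) (summand (n ∸ r) r) ⟨
    ∑ (suc n) (λ j → 2 ^ r * (n C r) * summand (n ∸ r) r j)
      ≡⟨ ∑-cong (suc n) (λ j _ → trans
           (cong (λ m → 2 ^ r * (n C r) * (((n ∸ r) C j) * (r C j) * ((m + j) C j))) (m∸n+n≡m r≤n))
           (lemma₂ (2 ^ r * (n C r)) ((n ∸ r) C j) (r C j) ((n + j) C j))) ⟩
    ∑ (suc n) (λ j → ((n + j) C j) * g r j) ∎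
    where
    lemma₁ : ∀ x y → x * (x * (x * 1)) * y ≡ y * x * (x * x)
    lemma₁ = solve-∀
    lemma₂ : ∀ s t u v → s * (t * u * v) ≡ v * (s * (u * t))
    lemma₂ = solve-∀
  inner : ∀ j → j ≤ n → ∑ (suc n) (λ r → ((n + j) C j) * g r j) ≡ macMahonTerm n j
  inner j j≤n = begin-equality
    ∑ (suc n) (λ r → ((n + j) C j) * g r j)
      ≡⟨ ∑-*ˡ (suc n) ((n + j) C j) (λ r → g r j) ⟩
    ((n + j) C j) * ∑ (suc n) (λ r → g r j)
      ≡⟨ cong (((n + j) C j) *_) (∑-inner n j j≤n) ⟩
    ((n + j) C j) * ((n C j) * ((n ∸ j) C j) * 2 ^ j * 3 ^ (n ∸ j ∸ j))
      ≡⟨ lemma ((n + j) C j) (n C j) ((n ∸ j) C j) (2 ^ j) (3 ^ (n ∸ j ∸ j)) ⟩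
    macMahonTerm n j ∎
    where
    lemma : ∀ s t u v w → s * (t * u * v * w) ≡ s * t * u * v * w
    lemma = solve-∀

-- Exact powers of 3

infix 4 _∥_

-- A record rather than a Σ-type, so that e can be inferred from e ∥ n.
record _∥_ (e n : ℕ) : Set where
  constructor exactly
  field
    cofactor   : ℕ
    3∤cofactor : 3 ∤ cofactor
    factors    : n ≡ cofactor * 3 ^ e

3-prime : Prime 3
3-prime = from-yes (prime? 3)

3∤⇒3∤* : ∀ {u v} → 3 ∤ u → 3 ∤ v → 3 ∤ u * v
3∤⇒3∤* {u} {v} 3∤u 3∤v 3∣uv = [ 3∤u , 3∤v ]′ (euclidsLemma u v 3-prime 3∣uv)

∥-unit : ∀ {u} → 3 ∤ u → 0 ∥ u
∥-unit {u} 3∤u = exactly u 3∤u (sym (*-identityʳ u))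

∥-pow : ∀ e → e ∥ 3 ^ e
∥-pow e = exactly 1 (from-no (3 ∣? 1)) (sym (*-identityˡ (3 ^ e)))

∥-* : ∀ {e f m n} → e ∥ m → f ∥ n → e + f ∥ m * n
∥-* {e} {f} (exactly u 3∤u refl) (exactly v 3∤v refl) = exactly (u * v) (3∤⇒3∤* 3∤u 3∤v) (begin-equality
    u * 3 ^ e * (v * 3 ^ f)   ≡⟨ lemma u (3 ^ e) v (3 ^ f) ⟩
    u * v * (3 ^ e * 3 ^ f)   ≡⟨ cong (u * v *_) (^-distribˡ-+-* 3 e f) ⟨
    u * v * 3 ^ (e + f)       ∎)
  where
  lemma : ∀ a b c d → a * b * (c * d) ≡ a * c * (b * d)
  lemma = solve-∀

∥⇒∣ : ∀ {e n} → e ∥ n → 3 ^ e ∣ n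
∥⇒∣ (exactly u _ n≡) = divides u n≡

∥⇒∤ : ∀ {e n} → e ∥ n → 3 ^ suc e ∤ n
∥⇒∤ {e} (exactly u 3∤u refl) 3^1+e∣n = 3∤u (*-cancelʳ-∣ (3 ^ e) 3^1+e∣n)
  where instance _ = m^n≢0 3 e

∣∤⇒∥ : ∀ {e n} → 3 ^ e ∣ n → 3 ^ suc e ∤ n → e ∥ n
∣∤⇒∥ {e} (divides u refl) 3^1+e∤n = exactly u (λ 3∣u → 3^1+e∤n (*-monoˡ-∣ (3 ^ e) 3∣u)) refl

-- Euclid's lemma strips one factor 3 from x at a time.
∣-unit-cancel : ∀ {u} → 3 ∤ u → ∀ h x → 3 ^ h ∣ x * u → 3 ^ h ∣ x
∣-unit-cancel 3∤u zero    x _ = 1∣ x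
∣-unit-cancel {u} 3∤u (suc h) x 3^1+h∣xu with euclidsLemma x u 3-prime (m*n∣⇒m∣ 3 (3 ^ h) 3^1+h∣xu)
... | inj₂ 3∣u = contradiction 3∣u 3∤u
... | inj₁ (divides y refl) =
  subst (3 ^ suc h ∣_) (*-comm 3 y) (*-monoʳ-∣ 3 (∣-unit-cancel 3∤u h y (*-cancelˡ-∣ 3 (subst (3 ^ suc h ∣_) (lemma y u) 3^1+h∣xu))))
  where
  lemma : ∀ y u → y * 3 * u ≡ 3 * (y * u)
  lemma = solve-∀

∣-∥-cancel : ∀ {e x a} h → 3 ^ (h + e) ∣ x * a → e ∥ a → 3 ^ h ∣ x
∣-∥-cancel {e} {x} h 3^h+e∣xa (exactly u 3∤u refl) = ∣-unit-cancel 3∤u h x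
  (*-cancelʳ-∣ (3 ^ e) (subst₂ _∣_ (^-distribˡ-+-* 3 h e) (sym (*-assoc x u (3 ^ e))) 3^h+e∣xa))
  where instance _ = m^n≢0 3 e

-- A further factor 3 in x would give one too many in `x * a`. This is how valuations are read off
-- from identities whose denominators have been cleared.
∥-∥-cancel : ∀ {e h x a} → h + e ∥ x * a → e ∥ a → h ∥ x
∥-∥-cancel {e} {h} {x} {a} h+e∥xa e∥a = ∣∤⇒∥ (∣-∥-cancel h (∥⇒∣ h+e∥xa) e∥a) λ 3^1+h∣x →
  ∥⇒∤ h+e∥xa (subst (_∣ x * a) (sym (^-distribˡ-+-* 3 (suc h) e)) (*-pres-∣ 3^1+h∣x (∥⇒∣ e∥a)))

^-monoʳ-∣ : ∀ {k l} → k ≤ l → 3 ^ k ∣ 3 ^ l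
^-monoʳ-∣ {k} k≤l with o , refl ← m≤n⇒∃[o]m+o≡n k≤l =
  subst (3 ^ k ∣_) (sym (^-distribˡ-+-* 3 k o)) (m∣m*n (3 ^ o))

∥-mono : ∀ {e f m n} → e ∥ m → f ∥ n → m ∣ n → e ≤ f
∥-mono e∥m f∥n m∣n = ≮⇒≥ λ f<e → ∥⇒∤ f∥n (∣-trans (^-monoʳ-∣ f<e) (∣-trans (∥⇒∣ e∥m) m∣n))

∥⇒ν₃≡ : ∀ {e n} .{{_ : ℤ.NonZero (+ n)}} → e ∥ n → ν₃ (+ n) ≡ e
∥⇒ν₃≡ {e} {n} e∥n = ≤-antisym
  (≮⇒≥ λ e<ν → ∥⇒∤ e∥n (∣-trans (^-monoʳ-∣ e<ν) (ν₃-divides (+ n))))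
  (ν₃-largest (+ n) e (∥⇒∣ e∥n))

∥-+ : ∀ {e m n} → e ∥ m → 3 ^ suc e ∣ n → e ∥ m + n
∥-+ {e} {m} {n} e∥m 3^1+e∣n = ∣∤⇒∥
  (∣m∣n⇒∣m+n (∥⇒∣ e∥m) (∣-trans (^-monoʳ-∣ (n≤1+n e)) 3^1+e∣n))
  (λ 3^1+e∣m+n → ∥⇒∤ e∥m (∣m+n∣m⇒∣n (subst (3 ^ suc e ∣_) (+-comm m n) 3^1+e∣m+n) 3^1+e∣n))

∣-∑ : ∀ {d} k {f} → (∀ i → d ∣ f i) → d ∣ ∑ k f
∣-∑ zero    d∣f = _ ∣0
∣-∑ (suc k) d∣f = ∣m∣n⇒∣m+n (d∣f 0) (∣-∑ k λ i → d∣f (suc i))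

-- The ultrametric principle: a unique term of least valuation determines the valuation of the sum.
∥-∑ : ∀ {e} k m {f} → m < k → e ∥ f m → (∀ i → i ≢ m → 3 ^ suc e ∣ f i) → e ∥ ∑ k f
∥-∑ (suc k) zero    _         e∥fm 3^1+e∣f = ∥-+ e∥fm (∣-∑ k λ i → 3^1+e∣f (suc i) λ ())
∥-∑ {e} (suc k) (suc m) {f} (s<s m<k) e∥fm 3^1+e∣f = subst (e ∥_) (+-comm (∑ k (λ i → f (suc i))) (f 0))
  (∥-+ (∥-∑ k m m<k e∥fm λ i i≢m → 3^1+e∣f (suc i) λ { refl → i≢m refl }) (3^1+e∣f 0 λ ()))

-- Legendre's formula for the prime 3

3∤1+q*3 : ∀ q → 3 ∤ 1 + q * 3
3∤1+q*3 q 3∣1+q*3 = from-no (3 ∣? 1) (∣m+n∣m⇒∣n (subst (3 ∣_) (+-comm 1 (q * 3)) 3∣1+q*3) (n∣m*n q))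

3∤2+q*3 : ∀ q → 3 ∤ 2 + q * 3
3∤2+q*3 q 3∣2+q*3 = from-no (3 ∣? 2) (∣m+n∣m⇒∣n (subst (3 ∣_) (+-comm 2 (q * 3)) 3∣2+q*3) (n∣m*n q))

-- Each block of three consecutive factors holds two units and one multiple of 3; the multiples 3,
-- 6, ..., 3q together give 3^q q!.
[q*3]! : ∀ q → ∃[ u ] 3 ∤ u × (q * 3) ! ≡ u * 3 ^ q * q !
[q*3]! zero = 1 , from-no (3 ∣? 1) , refl
[q*3]! (suc q) with u , 3∤u , [q*3]!≡ ← [q*3]! q =
  (2 + q * 3) * (1 + q * 3) * u ,
  3∤⇒3∤* (3∤⇒3∤* (3∤2+q*3 q) (3∤1+q*3 q)) 3∤u , (begin-equality
    (3 + q * 3) * ((2 + q * 3) * ((1 + q * 3) * (q * 3) !))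
      ≡⟨ cong (λ x → (3 + q * 3) * ((2 + q * 3) * ((1 + q * 3) * x))) [q*3]!≡ ⟩
    (3 + q * 3) * ((2 + q * 3) * ((1 + q * 3) * (u * 3 ^ q * q !)))
      ≡⟨ lemma q u (3 ^ q) (q !) ⟩
    (2 + q * 3) * (1 + q * 3) * u * 3 ^ suc q * suc q ! ∎)
  where
  lemma : ∀ q u p f → (3 + q * 3) * ((2 + q * 3) * ((1 + q * 3) * (u * p * f)))
                    ≡ (2 + q * 3) * (1 + q * 3) * u * (3 * p) * (suc q * f)
  lemma = solve-∀

∥-[q*3]! : ∀ q {e} → e ∥ q ! → q + e ∥ (q * 3) !
∥-[q*3]! q e∥q! with u , 3∤u , [q*3]!≡ ← [q*3]! q =
  subst (q + _ ∥_) (sym [q*3]!≡) (∥-* (∥-* (∥-unit 3∤u) (∥-pow q)) e∥q!)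

-- For m = d + 3q with a digit d, the factors above 3q are units, so the valuation of m! is q more
-- than that of q!. Adding 2e on the left keeps subtraction and halving out of the formula.
legendre-digits : (ds : Expansion 3) →
  ∃[ e ] e ∥ (fromDigits ds) ! × sum (map toℕ ds) + 2 * e ≡ fromDigits ds
legendre-digits [] = 0 , ∥-pow 0 , refl
legendre-digits (d ∷ ds) with e , e∥q! , s+2e≡q ← legendre-digits ds =
  q + e , ∥-digit d , (begin-equality
    toℕ d + s + 2 * (q + e)      ≡⟨ lemma (toℕ d) s q e ⟩
    toℕ d + (s + 2 * e + 2 * q)  ≡⟨ cong (λ x → toℕ d + (x + 2 * q)) s+2e≡q ⟩
    toℕ d + (q + 2 * q)          ≡⟨ cong (λ x → toℕ d + x) (*-comm 3 q) ⟩
    toℕ d + q * 3                ∎)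
  where
  q = fromDigits ds
  s = sum (map toℕ ds)
  lemma : ∀ d s q e → d + s + 2 * (q + e) ≡ d + (s + 2 * e + 2 * q)
  lemma = solve-∀
  ∥-digit : ∀ (d : Fin 3) → q + e ∥ (toℕ d + q * 3) !
  ∥-digit Fin.zero = ∥-[q*3]! q e∥q!
  ∥-digit (Fin.suc Fin.zero) = ∥-* (∥-unit (3∤1+q*3 q)) (∥-[q*3]! q e∥q!)
  ∥-digit (Fin.suc (Fin.suc Fin.zero)) =
    ∥-* (∥-unit (3∤2+q*3 q)) (∥-* (∥-unit (3∤1+q*3 q)) (∥-[q*3]! q e∥q!))

legendre : ∀ m → ∃[ e ] e ∥ m ! × s₃ m + 2 * e ≡ m
legendre m = helper (toDigits 3 m)
  where
  -- Generalising over the pair returned by `toDigits` lets the match on `refl` replace m by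
  -- `fromDigits ds`.
  helper : (x : ∃[ ds ] fromDigits ds ≡ m) → ∃[ e ] e ∥ m ! × sum (map toℕ (proj₁ x)) + 2 * e ≡ m
  helper (ds , refl) = legendre-digits ds

ν! : ℕ → ℕ
ν! m = proj₁ (legendre m)

ν!-∥ : ∀ m → ν! m ∥ m !
ν!-∥ m = proj₁ (proj₂ (legendre m))

s₃+2ν!≡ : ∀ m → s₃ m + 2 * ν! m ≡ m
s₃+2ν!≡ m = proj₂ (proj₂ (legendre m))

ν!-mono : ∀ {m n} → m ≤ n → ν! m ≤ ν! n
ν!-mono {m} {n} m≤n = ∥-mono (ν!-∥ m) (ν!-∥ n) (m≤n⇒m!∣n! m≤n)

ν!-*3 : ∀ q → q + ν! q ≤ ν! (q * 3)
ν!-*3 q = ∥-mono (∥-[q*3]! q (ν!-∥ q)) (ν!-∥ (q * 3)) ∣-refl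

digits-zero : (ds : Expansion 3) → sum (map toℕ ds) ≡ 0 → fromDigits ds ≡ 0
digits-zero []       _   = refl
digits-zero (d ∷ ds) s≡0 = cong₂ (λ d q → d + q * 3)
  (m+n≡0⇒m≡0 (toℕ d) s≡0) (digits-zero ds (m+n≡0⇒n≡0 (toℕ d) s≡0))

s₃-pos : ∀ m → 0 < m → 0 < s₃ m
s₃-pos m 0<m = n≢0⇒n>0 λ s≡0 →
  n>0⇒n≢0 0<m (trans (sym (proj₂ (toDigits 3 m))) (digits-zero (proj₁ (toDigits 3 m)) s≡0))

-- Strictness comes from the positive digit sum. It later supplies the additional factor 3 in the
-- terms with j < ⌊n/2⌋.
2ν!< : ∀ m → 0 < m → 2 * ν! m < m
2ν!< m 0<m = subst (2 * ν! m <_) (s₃+2ν!≡ m) (m<n+m (2 * ν! m) (s₃-pos m 0<m))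

-- Valuations of the terms of MacMahon's sum

macMahonTerm-! : ∀ j d → let n = j + (j + d) in
  macMahonTerm n j * (j ! * (j ! * (j ! * d !))) ≡ (n + j) ! * 2 ^ j * 3 ^ d
macMahonTerm-! j d = begin-equality
  ((n + j) C j) * (n C j) * ((n ∸ j) C j) * 2 ^ j * 3 ^ (n ∸ j ∸ j) * (j ! * (j ! * (j ! * d !)))
    ≡⟨ cong (λ i → ((n + j) C j) * (n C j) * ((n ∸ j) C j) * 2 ^ j * 3 ^ i * (j ! * (j ! * (j ! * d !)))) n∸j∸j≡d ⟩
  ((n + j) C j) * (n C j) * ((n ∸ j) C j) * 2 ^ j * 3 ^ d * (j ! * (j ! * (j ! * d !)))
    ≡⟨ lemma ((n + j) C j) (n C j) ((n ∸ j) C j) (2 ^ j) (3 ^ d) (j !) (j ! * (j ! * d !)) ⟩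
  ((n + j) C j) * (j ! * ((n C j) * ((n ∸ j) C j) * (j ! * (j ! * d !)))) * 2 ^ j * 3 ^ d
    ≡⟨ cong (λ x → ((n + j) C j) * (j ! * x) * 2 ^ j * 3 ^ d) (C-trinomial j j d) ⟩
  ((n + j) C j) * (j ! * n !) * 2 ^ j * 3 ^ d
    ≡⟨ cong (λ i → (i C j) * (j ! * n !) * 2 ^ j * 3 ^ d) (+-comm n j) ⟩
  ((j + n) C j) * (j ! * n !) * 2 ^ j * 3 ^ d
    ≡⟨ cong (λ x → x * 2 ^ j * 3 ^ d) (C-! j n) ⟩
  (j + n) ! * 2 ^ j * 3 ^ d
    ≡⟨ cong (λ i → i ! * 2 ^ j * 3 ^ d) (+-comm j n) ⟩
  (n + j) ! * 2 ^ j * 3 ^ d ∎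
  where
  n = j + (j + d)
  n∸j∸j≡d : n ∸ j ∸ j ≡ d
  n∸j∸j≡d = trans (cong (_∸ j) (m+n∸m≡n j (j + d))) (m+n∸m≡n j d)
  lemma : ∀ a b c p q f g → a * b * c * p * q * (f * g) ≡ a * (f * (b * c * g)) * p * q
  lemma = solve-∀

∥-2^ : ∀ j → 0 ∥ 2 ^ j
∥-2^ zero    = ∥-pow 0
∥-2^ (suc j) = ∥-* (∥-unit {2} (from-no (3 ∣? 2))) (∥-2^ j)

-- Here n = 2m + ε, so n + m = 3m + ε and (n+m)! has valuation m + L. Since m = s₃(m) + 2L, the
-- numerator has valuation s₃(m) + 3L + ε, and m!³ ε! removes 3L.
macMahonTerm-central : ∀ m ε → ε ≤ 1 → s₃ m + ε ∥ macMahonTerm (m + (m + ε)) m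
macMahonTerm-central m ε ε≤1 = ∥-∥-cancel
  (subst₂ _∥_ exponents≡ (sym (macMahonTerm-! m ε)) (∥-* (∥-* (top ε ε≤1) (∥-2^ m)) (∥-pow ε)))
  (∥-* (ν!-∥ m) (∥-* (ν!-∥ m) (∥-* (ν!-∥ m) (small ε ε≤1))))
  where
  L = ν! m
  small : ∀ ε → ε ≤ 1 → 0 ∥ ε !
  small 0 _ = ∥-pow 0
  small 1 _ = ∥-pow 0
  small (2+ _) (s≤s ())
  n+m≡ : ∀ m ε → m + (m + ε) + m ≡ ε + m * 3
  n+m≡ = solve-∀
  digit : ∀ ε → ε ≤ 1 → m + L ∥ (ε + m * 3) !
  digit 0 _ = ∥-[q*3]! m (ν!-∥ m)
  digit 1 _ = ∥-* (∥-unit (3∤1+q*3 m)) (∥-[q*3]! m (ν!-∥ m))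
  digit (2+ _) (s≤s ())
  top : ∀ ε → ε ≤ 1 → m + L ∥ (m + (m + ε) + m) !
  top ε ε≤1 = subst (λ i → m + L ∥ i !) (sym (n+m≡ m ε)) (digit ε ε≤1)
  lemma : ∀ s L ε → s + 2 * L + L + 0 + ε ≡ s + ε + (L + (L + (L + 0)))
  lemma = solve-∀
  exponents≡ : m + L + 0 + ε ≡ s₃ m + ε + (L + (L + (L + 0)))
  exponents≡ = trans (cong (λ x → x + L + 0 + ε) (sym (s₃+2ν!≡ m))) (lemma (s₃ m) L ε)

-- At n = 2 m + ε and j = m - i < m, the right-hand side is the valuation of
-- (n+j)! 2^j 3^d with d = n - 2j. The estimate combines 2 ν!(d) < d with
-- n + j ≥ 3 (j + ε).
exponent-bound : ∀ j i ε → 0 < i → ε ≤ 1 → let m = j + i; d = 2 * i + ε in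
  suc (s₃ m + ε) + (ν! j + (ν! j + (ν! j + ν! d))) ≤ ν! (j + (j + d) + j) + 0 + d
exponent-bound j i ε 0<i ε≤1 = begin
  suc (s₃ m + ε) + (ν! j + (ν! j + (ν! j + ν! d)))
    ≡⟨ lemma₁ (s₃ m) ε (ν! j) (ν! d) ⟩
  s₃ m + 2 * ν! j + ν! j + ε + suc (ν! d)
    -- Two copies of `ν! j` are raised to `ν! m` so that Legendre's formula for m applies; the
    -- successor is absorbed by ν!(d) < i + ε.
    ≤⟨ +-mono-≤ (+-monoˡ-≤ ε (+-monoˡ-≤ (ν! j) (+-monoʳ-≤ (s₃ m) (*-monoʳ-≤ 2 (ν!-mono (m≤m+n j i)))))) ν!d<i+ε ⟩
  s₃ m + 2 * ν! m + ν! j + ε + (i + ε)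
    ≡⟨ cong (λ x → x + ν! j + ε + (i + ε)) (s₃+2ν!≡ m) ⟩
  j + i + ν! j + ε + (i + ε)
    ≡⟨ lemma₂ j i ε (ν! j) ⟩
  j + ε + ν! j + 0 + d
    -- The chain is j + ε + ν!(j) ≤ j + ε + ν!(j + ε) ≤ ν!(3(j + ε)) ≤ ν!(n + j), where n = 2j + d.
    ≤⟨ +-monoˡ-≤ d (+-monoˡ-≤ 0 (≤-trans (+-monoʳ-≤ (j + ε) (ν!-mono (m≤m+n j ε)))
         (≤-trans (ν!-*3 (j + ε)) (ν!-mono [j+ε]*3≤n+j)))) ⟩
  ν! (j + (j + d) + j) + 0 + d ∎
  where
  m = j + i
  d = 2 * i + ε
  ν!d<i+ε : ν! d < i + ε
  ν!d<i+ε = *-cancelˡ-< 2 _ _ (begin-strict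
    2 * ν! d      <⟨ 2ν!< d (≤-trans 0<i (≤-trans (m≤m+n i (i + 0)) (m≤m+n (2 * i) ε))) ⟩
    2 * i + ε     ≤⟨ +-monoʳ-≤ (2 * i) (m≤n*m ε 2) ⟩
    2 * i + 2 * ε ≡⟨ *-distribˡ-+ 2 i ε ⟨
    2 * (i + ε)   ∎)
  lemma₃ : ∀ j ε → (j + ε) * 3 ≡ j + (j + (2 * ε + ε)) + j
  lemma₃ = solve-∀
  [j+ε]*3≤n+j : (j + ε) * 3 ≤ j + (j + d) + j
  [j+ε]*3≤n+j = begin
    (j + ε) * 3              ≡⟨ lemma₃ j ε ⟩
    j + (j + (2 * ε + ε)) + j
      ≤⟨ +-monoˡ-≤ j (+-monoʳ-≤ j (+-monoʳ-≤ j (+-monoˡ-≤ ε (*-monoʳ-≤ 2 (≤-trans ε≤1 0<i))))) ⟩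
    j + (j + (2 * i + ε)) + j ∎
  lemma₁ : ∀ s ε a b → suc (s + ε) + (a + (a + (a + b))) ≡ s + 2 * a + a + ε + suc b
  lemma₁ = solve-∀
  lemma₂ : ∀ j i ε a → j + i + a + ε + (i + ε) ≡ j + ε + a + 0 + (2 * i + ε)
  lemma₂ = solve-∀

macMahonTerm-below : ∀ j i ε → 0 < i → ε ≤ 1 → let m = j + i in
  3 ^ suc (s₃ m + ε) ∣ macMahonTerm (m + (m + ε)) j
macMahonTerm-below j i ε 0<i ε≤1 = subst (λ n → 3 ^ suc (s₃ (j + i) + ε) ∣ macMahonTerm n j) (lemma j i ε)
  (∣-∥-cancel (suc (s₃ (j + i) + ε))
    (∣-trans (^-monoʳ-∣ (exponent-bound j i ε 0<i ε≤1)) (∥⇒∣ (subst (ν! (n + j) + 0 + d ∥_)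
      (sym (macMahonTerm-! j d)) (∥-* (∥-* (ν!-∥ (n + j)) (∥-2^ j)) (∥-pow d)))))
    (∥-* (ν!-∥ j) (∥-* (ν!-∥ j) (∥-* (ν!-∥ j) (ν!-∥ d)))))
  where
  d = 2 * i + ε
  n = j + (j + d)
  lemma : ∀ j i ε → j + (j + (2 * i + ε)) ≡ j + i + (j + i + ε)
  lemma = solve-∀

-- The exponent of 3 is truncated to 0 in this range, so the vanishing comes from the binomial
-- coefficients.
macMahonTerm-above : ∀ n j → n < j + j → macMahonTerm n j ≡ 0
macMahonTerm-above n j n<j+j = begin-equality
  ((n + j) C j) * (n C j) * ((n ∸ j) C j) * 2 ^ j * 3 ^ (n ∸ j ∸ j)
    ≡⟨ cong (λ x → x * 2 ^ j * 3 ^ (n ∸ j ∸ j)) (*-assoc ((n + j) C j) (n C j) _) ⟩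
  ((n + j) C j) * ((n C j) * ((n ∸ j) C j)) * 2 ^ j * 3 ^ (n ∸ j ∸ j)
    ≡⟨ cong (λ x → ((n + j) C j) * x * 2 ^ j * 3 ^ (n ∸ j ∸ j)) (C-swap-zero n j j n<j+j) ⟩
  ((n + j) C j) * 0 * 2 ^ j * 3 ^ (n ∸ j ∸ j)
    ≡⟨ cong (λ x → x * 2 ^ j * 3 ^ (n ∸ j ∸ j)) (*-zeroʳ ((n + j) C j)) ⟩
  0 ∎

macMahonTerm-off-central : ∀ m ε → ε ≤ 1 → ∀ j → j ≢ m → 3 ^ suc (s₃ m + ε) ∣ macMahonTerm (m + (m + ε)) j
macMahonTerm-off-central m ε ε≤1 j j≢m with <-cmp j m
... | tri≈ _ j≡m _ = contradiction j≡m j≢m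
... | tri< j<m _ _ with o , refl ← m≤n⇒∃[o]m+o≡n j<m =
  subst (λ m → 3 ^ suc (s₃ m + ε) ∣ macMahonTerm (m + (m + ε)) j) (+-suc j o)
    (macMahonTerm-below j (suc o) ε z<s ε≤1)
-- From ε ≤ 1 and m < j follows m + ε ≤ j, hence n = m + (m + ε) < j + j.
... | tri> _ _ m<j = subst (3 ^ suc (s₃ m + ε) ∣_)
  (sym (macMahonTerm-above (m + (m + ε)) j (+-mono-<-≤ m<j
    (≤-trans (+-monoʳ-≤ m ε≤1) (≤-trans (≤-reflexive (+-comm m 1)) m<j)))))
  (_ ∣0)

-- Writing n as m + (m + ε) treats both parities at once, with ε the remainder modulo 2.
∥-cubeSum : ∀ m ε → ε ≤ 1 → let n = m + (m + ε) in
  s₃ m + ε ∥ sum (map (λ r → (n C r) ^ 3 * 2 ^ r) (upTo (suc n)))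
∥-cubeSum m ε ε≤1 = subst (s₃ m + ε ∥_)
  (sym (trans (cong sum (map-upTo (λ r → (n C r) ^ 3 * 2 ^ r) (suc n))) (macMahon n)))
  (∥-∑ (suc n) m (s≤s (m≤m+n m (m + ε))) (macMahonTerm-central m ε ε≤1) (macMahonTerm-off-central m ε ε≤1))
  where
  n = m + (m + ε)

-- Specialisation to odd and even n

odd-half : ∀ n → 2 ∤ n → n ≡ (n ∸ 1) / 2 + ((n ∸ 1) / 2 + 1)
odd-half n 2∤n with n % 2 in n%2≡ | m≡m%n+[m/n]*n n 2 | m%n<n n 2
... | 0 | _  | _ = contradiction (m%n≡0⇒n∣m n 2 n%2≡) 2∤n
... | 1 | n≡ | _ = begin-equality
  n                               ≡⟨ n≡ ⟩
  1 + n / 2 * 2                   ≡⟨ lemma (n / 2) ⟩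
  n / 2 + (n / 2 + 1)             ≡⟨ cong (λ q → q + (q + 1)) half≡ ⟨
  (n ∸ 1) / 2 + ((n ∸ 1) / 2 + 1) ∎
  where
  half≡ : (n ∸ 1) / 2 ≡ n / 2
  half≡ = trans (cong (λ x → (x ∸ 1) / 2) n≡) (m*n/n≡m (n / 2) 2)
  lemma : ∀ q → 1 + q * 2 ≡ q + (q + 1)
  lemma = solve-∀
... | 2+ _ | _ | s≤s (s≤s ())

even-half : ∀ n → 2 ∣ n → n ≡ n / 2 + (n / 2 + 0)
-- The product `2 * (n / 2)` unfolds to the required form with ε = 0.
even-half n 2∣n = trans (sym (m/n*n≡m 2∣n)) (*-comm (n / 2) 2)

theorem1 : (n : ℕ) → n ≥ 1 →
    (2 ∤ n →
    ν₃ (+ sum (map (λ r → (n C r) ^ 3 * 2 ^ r) (upTo (suc n)))) ≡ s₃ ((n ∸ 1) / 2) + 1)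
    ×
    (2 ∣ n →
    ν₃ (+ sum (map (λ r → (n C r) ^ 3 * 2 ^ r) (upTo (suc n)))) ≡ s₃ (n / 2))
theorem1 n _ = odd , even
  where
  -- As a function of its index, the sum can be rewritten along `odd-half` and `even-half` without
  -- changing the argument of `s₃`. Its r = 0 term computes to 1, so it is visibly nonzero.
  cubeSum : ℕ → ℕ
  cubeSum n = sum (map (λ r → (n C r) ^ 3 * 2 ^ r) (upTo (suc n)))
  odd : 2 ∤ n → ν₃ (+ cubeSum n) ≡ s₃ ((n ∸ 1) / 2) + 1
  odd 2∤n = ∥⇒ν₃≡ (subst (λ x → s₃ ((n ∸ 1) / 2) + 1 ∥ cubeSum x) (sym (odd-half n 2∤n))
    (∥-cubeSum ((n ∸ 1) / 2) 1 ≤-refl))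
  even : 2 ∣ n → ν₃ (+ cubeSum n) ≡ s₃ (n / 2)
  even 2∣n = ∥⇒ν₃≡ (subst₂ (λ e x → e ∥ cubeSum x) (+-identityʳ (s₃ (n / 2))) (sym (even-half n 2∣n))
    (∥-cubeSum (n / 2) 0 z≤n))
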